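{- Let $G$ be a graph such that every induced subgraph $H$ of $G$ (including $G$ itself) satisfies \[\chi(H) \leq \max\left\{\left\lceil \frac{7}{6}\omega(H) \right\rceil, \left\lceil \frac{\omega(H) + \Delta(H) + 1}{2}\right\rceil\right\}.\] Then \[\chi(G) \leq \left\lceil \frac{\omega(G) + \Delta(G) + 1}{2}\right\rceil.\]
   Context: Graphs are finite, simple and undirected. $\chi(G)$ denotes the chromatic number of $G$, $\omega(G)$ the clique number (the number of vertices in a largest clique), and $\Delta(G)$ the maximum degree. -}

module Defs where

open import Level using (0ℓ)
open import Data.Fin.Base using (Fin; zero; finToFun; funToFin)
open import Data.Fin.Properties using (any?; all?; finToFun-funToFin)
  renaming (_≟_ to _≟ᶠ_)
open import Data.Fin.Subset using (Subset; _∈_; ∣_∣; ⊥)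
open import Data.Fin.Subset.Properties
  using (anySubset?; _∈?_; ∣p∣≤n; ∣⊥∣≡0; ∉⊥)
open import Data.List.Base using (map; filter; upTo; allFin)
open import Data.List.Extrema.Nat
  using (min; max; min≤v⁺; v≤max⁺; argmin-all; argmax-all; argmax-sel)
open import Data.List.Membership.Propositional using (lose)
open import Data.List.Membership.Propositional.Properties
  using (∈-filter⁺; ∈-upTo⁺; ∈-allFin; ∈-map⁺; ∈-map⁻)
open import Data.List.Relation.Unary.All.Properties using (all-filter)
open import Data.Nat.Base using (ℕ; suc; _≤_; s≤s)
open import Data.Nat.Properties using (≤-refl; <-≤-connex; n≤0⇒n≡0; _≟_)
open import Data.Product.Base using (∃-syntax; Σ-syntax; _×_; _,_)
open import Data.Sum.Base using (inj₁; inj₂)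
open import Data.Vec.Base using (tabulate)
open import Function.Base using (_on_; id; _∘_)
open import Function.Bundles using (_↣_; Injection)
open import Relation.Binary.Core using (Rel)
open import Relation.Binary.Definitions using (Decidable; Symmetric; Irreflexive)
open import Relation.Binary.PropositionalEquality.Core
  using (_≡_; _≢_; refl; sym; trans; cong; subst; subst₂)
open import Relation.Nullary.Decidable using (does; map′; _→-dec_; _×-dec_; ¬?)
open import Relation.Nullary.Negation using (contradiction)
import Relation.Unary as U

-- Finite simple graphs, with vertex set normalised to Fin n.
record Graph (n : ℕ) : Set₁ where
  field
    Adj     : Rel (Fin n) 0ℓ
    adj?    : Decidable Adj
    adj-sym : Symmetric Adj
    irrefl  : Irreflexive _≡_ Adj

open Graph public

private
  variable
    n : ℕ

-- A vertex subset of size m is presented by an injection from Fin m; every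
-- induced subgraph arises in this way, up to relabelling its vertices.
induced : ∀ {m} → Graph n → Fin m ↣ Fin n → Graph m
induced G f = record
  { Adj     = Adj G on to
  ; adj?    = λ u v → adj? G (to u) (to v)
  ; adj-sym = adj-sym G
  ; irrefl  = λ u≡v → irrefl G (cong to u≡v)
  }
  where open Injection f using (to)

neighbours : Graph n → Fin n → Subset n
neighbours G v = tabulate (does ∘ adj? G v)

degree : Graph n → Fin n → ℕ
degree G v = ∣ neighbours G v ∣

-- The first argument of max makes Δ equal to 0 on the graph without vertices.
Δ : Graph n → ℕ
Δ {n} G = max 0 (map (degree G) (allFin n))

IsClique : Graph n → Subset n → Set
IsClique G S = ∀ u v → u ∈ S → v ∈ S → u ≢ v → Adj G u v

isClique? : (G : Graph n) → U.Decidable (IsClique G)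
isClique? G S = all? λ u → all? λ v →
  u ∈? S →-dec v ∈? S →-dec ¬? (u ≟ᶠ v) →-dec adj? G u v

HasClique : Graph n → ℕ → Set
HasClique {n} G k = ∃[ S ] (IsClique G S × ∣ S ∣ ≡ k)

hasClique? : (G : Graph n) → U.Decidable (HasClique G)
hasClique? G k = anySubset? λ S → isClique? G S ×-dec ∣ S ∣ ≟ k

ω : Graph n → ℕ
ω {n} G = max 0 (filter (hasClique? G) (upTo (suc n)))

IsProper : Graph n → ∀ {k} → (Fin n → Fin k) → Set
IsProper G c = ∀ u v → Adj G u v → c u ≢ c v

Colourable : Graph n → ℕ → Set
Colourable {n} G k = Σ[ c ∈ (Fin n → Fin k) ] IsProper G c

isProper? : (G : Graph n) → ∀ {k} → U.Decidable (IsProper G {k})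
isProper? G c = all? λ u → all? λ v → adj? G u v →-dec ¬? (c u ≟ᶠ c v)

-- The k ^ n colour assignments are enumerated through their codes.
colourable? : (G : Graph n) → U.Decidable (Colourable G)
colourable? {n} G k = map′
  (λ (i , p) → finToFun i , p)
  (λ (c , p) → funToFin c , λ u v uv →
     p u v uv ∘ subst₂ _≡_ (finToFun-funToFin c u) (finToFun-funToFin c v))
  (any? (isProper? G ∘ finToFun {k} {n}))

-- The least number of colours; n colours always suffice, so fewer than n are
-- searched.
χ : Graph n → ℕ
χ {n} G = min n (filter (colourable? G) (upTo n))

χ-colourable : (G : Graph n) → Colourable G (χ G)
χ-colourable {n} G = argmin-all id {P = Colourable G}
  (id , λ { u .u uu refl → irrefl G refl uu })
  (all-filter (colourable? G) (upTo n))

χ-least : (G : Graph n) → ∀ {k} → Colourable G k → χ G ≤ k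
χ-least {n} G {k} c with <-≤-connex k n
... | inj₁ k<n = min≤v⁺ n _ (inj₂
  (lose (∈-filter⁺ (colourable? G) (∈-upTo⁺ k<n) c) ≤-refl))
... | inj₂ n≤k = min≤v⁺ n (filter (colourable? G) (upTo n)) (inj₁ n≤k)

ω-clique : (G : Graph n) → HasClique G (ω G)
ω-clique {n} G = argmax-all id {P = HasClique G}
  (⊥ , (λ _ _ u∈⊥ _ _ → contradiction u∈⊥ ∉⊥) , ∣⊥∣≡0 n)
  (all-filter (hasClique? G) (upTo (suc n)))

ω-greatest : (G : Graph n) → ∀ S → IsClique G S → ∣ S ∣ ≤ ω G
ω-greatest {n} G S q = v≤max⁺ 0 _ (inj₂
  (lose (∈-filter⁺ (hasClique? G) (∈-upTo⁺ (s≤s (∣p∣≤n S))) (S , q , refl))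
        ≤-refl))

degree≤Δ : (G : Graph n) → ∀ v → degree G v ≤ Δ G
degree≤Δ G v = v≤max⁺ 0 _ (inj₂ (lose (∈-map⁺ (degree G) (∈-allFin v)) ≤-refl))

Δ-attained : (G : Graph (suc n)) → ∃[ v ] degree G v ≡ Δ G
Δ-attained {n} G with argmax-sel id 0 (map (degree G) (allFin (suc n)))
... | inj₂ Δ∈ = let v , _ , eq = ∈-map⁻ (degree G) Δ∈ in v , sym eq
... | inj₁ Δ≡0 = zero , trans
  (n≤0⇒n≡0 (subst (degree G zero ≤_) Δ≡0 (degree≤Δ G zero)))
  (sym Δ≡0)

{-# OPTIONS --safe #-}
module Submission where

-- Write w for the clique number and s for the maximum degree plus one.
--
-- If 7 w ≤ 3 (w + s), the bound with 7/6 never exceeds the other one and there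
-- is nothing to prove.  Otherwise 3 s ≤ 4 w.  In that case some independent set
-- meets every maximum clique (hitting-set).  Extend it to a maximal independent
-- set J and delete J.  The clique number drops because J meets every maximum
-- clique, the maximum degree drops because every remaining vertex has a
-- neighbour in J, and the chromatic number drops by at most one because J can
-- be given a colour of its own.  The bound ⌈(w + s)/2⌉ therefore drops by at
-- least one, and induction on the number of vertices finishes the proof.  If J
-- contains all vertices, one colour suffices and the bound is at least one.
--
-- The hitting set is found as follows.  A vertex in two maximum cliques is
-- adjacent to all other vertices of their union, so the union has at most s
-- elements and the intersection at least 2 w - s, which is more than half of w.
-- Hence meeting is a transitive relation on maximum cliques (meets-trans).
-- Hajnal's inequality (the record Hajnal) says that the intersection and the
-- union of a family of maximum cliques have at least 2 w elements in total.  So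
-- all maximum cliques that meet a given one share a core of at least 2 w - s
-- vertices.  A vertex of a maximum clique has at most d = s - w neighbours with
-- which it lies in no common maximum clique, and 2 d ≤ 2 w - s.  By Haxell's
-- theorem (independent-transversal) one can choose one vertex in the core of
-- each class of meeting maximum cliques so that the chosen vertices are
-- independent.
--
-- Haxell's theorem is proved in a rooted form (extends): given an independent
-- transversal of the other parts, there is one that also uses the root part W.
-- Add the edges at W one at a time.  When the new edge joins the root x to the
-- pick y of a part V, merge V into W and remove the neighbours of x and y; a
-- rooted transversal for the merged parts becomes one for the original parts
-- after adding y or x.  Merging adds at least 2 d vertices to W and removes at
-- most 2 d vertices, so W is never exhausted.

open import Defs
import Data.Bool.Properties as Bool
open import Data.Fin.Base using (Fin; zero; suc)
open import Data.Fin.Properties as Fin using (any?) renaming (_≟_ to _≟ᶠ_)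
open import Data.Fin.Subset using
  (Subset; inside; outside; _∈_; _∉_; _⊆_; _∪_; _∩_; ⊥; ⊤; ⁅_⁆; ∣_∣; Empty; Nonempty)
open import Data.Fin.Subset.Properties
open import Data.Integer.Base as ℤ using (ℤ; +_; -[1+_])
import Data.Integer.DivMod as ℤ
import Data.Integer.Properties as ℤ
open import Data.List.Base using
  (List; []; _∷_; _++_; allFin; cartesianProduct; filter; foldr; length; lookup; map)
import Data.List.Membership.DecPropositional as DecMembership
open import Data.List.Membership.Propositional using (find; lose)
  renaming (_∈_ to _∈ˡ_; _∉_ to _∉ˡ_)
open import Data.List.Membership.Propositional.Properties using
  ( ∈-++⁺ˡ; ∈-++⁺ʳ; ∈-allFin; ∈-cartesianProduct⁺; ∈-filter⁺; ∈-filter⁻; ∈-lookup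
  ; ∈-map⁺; ∈-map⁻ )
open import Data.List.Properties using (filter-notAll)
open import Data.List.Relation.Unary.All as All using ()
open import Data.List.Relation.Unary.AllPairs using (_∷_)
open import Data.List.Relation.Unary.Any as Any using (Any; here; there)
open import Data.List.Relation.Unary.Any.Properties using (lookup-index)
open import Data.List.Relation.Unary.Unique.Propositional using (Unique)
open import Data.List.Relation.Unary.Unique.Propositional.Properties using (allFin⁺; filter⁺)
open import Data.Nat.Base using
  (ℕ; zero; suc; _+_; _*_; _∸_; _≤_; _<_; z≤n; s≤s; s≤s⁻¹; ⌈_/2⌉; ⌊_/2⌋)
open import Data.Nat.Properties as ℕ using (≤-refl; ≤-trans)
open import Data.Nat.Solver using (module +-*-Solver)
open import Data.Product.Base using (∃-syntax; _×_; _,_; proj₁; proj₂)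
import Data.Product.Properties as Product
open import Data.Rational.Base as ℚ using (ℚ; mkℚ; toℚᵘ; _/_; ceiling; floor; ↥_; ↧_)
import Data.Rational.Properties as ℚ
open import Data.Rational.Unnormalised.Base using (mkℚᵘ; *≡*) renaming (_≃_ to _≃ᵘ_)
import Data.Rational.Unnormalised.Properties as ℚᵘ
open import Data.Sum.Base using (_⊎_; inj₁; inj₂; [_,_]′; map₁)
open import Data.Vec.Base as Vec using ([]; _∷_)
open import Data.Vec.Properties as Vec using ([]=⇒lookup; lookup⇒[]=; lookup∘tabulate)
open import Function.Base using (_∘_; id)
open import Function.Bundles using (_↣_; mk↣; Injection)
open import Function.Construct.Composition using (_↣-∘_)
open import Function.Construct.Identity using (↣-id)
open import Function.Definitions using (Injective)
open import Relation.Binary.Definitions using (DecidableEquality)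
open import Relation.Binary.PropositionalEquality hiding (J)
open import Relation.Nullary.Decidable using
  (Dec; yes; no; does; dec-true; decidable-stable; ¬?; _×-dec_; _⊎-dec_)
open import Relation.Nullary.Negation using (¬_; contradiction)

private
  variable
    m n : ℕ

-- Ceilings of rational numbers

⌊p⌋*↧p≤↥p : ∀ p → ⌊ p ⌋ ℤ.* ↧ p ℤ.≤ ↥ p
⌊p⌋*↧p≤↥p p@record{} = ℤ.[n/d]*d≤n (↥ p) (↧ p)

z*↧p≤↥p⇒z≤⌊p⌋ : ∀ p z → z ℤ.* ↧ p ℤ.≤ ↥ p → z ℤ.≤ ⌊ p ⌋
z*↧p≤↥p⇒z≤⌊p⌋ p@(mkℚ i d-1 _) z zd≤i =
  subst (z ℤ.≤_) (ℤ.pred-suc ⌊ p ⌋) (ℤ.i<j⇒i≤pred[j] z<1+⌊p⌋)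
  where
  open ℤ.≤-Reasoning
  z<1+⌊p⌋ : z ℤ.< ℤ.suc ⌊ p ⌋
  z<1+⌊p⌋ = ℤ.*-cancelʳ-<-nonNeg (↧ p) (begin-strict
    z ℤ.* ↧ p                       ≤⟨ zd≤i ⟩
    i                               <⟨ ℤ.n<s[n/ℕd]*d i (suc d-1) ⟩
    ℤ.suc (i ℤ./ℕ suc d-1) ℤ.* ↧ p  ≡⟨ cong (λ q → ℤ.suc q ℤ.* ↧ p) (ℤ.div-pos-is-/ℕ i (suc d-1)) ⟨
    ℤ.suc ⌊ p ⌋ ℤ.* ↧ p             ∎)

⌈p⌉≡-⌊-p⌋ : ∀ p → ⌈ p ⌉ ≡ ℤ.- ⌊ ℚ.- p ⌋
⌈p⌉≡-⌊-p⌋ record{} = refl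

↥p≤z*↧p⇒⌈p⌉≤z : ∀ p z → ↥ p ℤ.≤ z ℤ.* ↧ p → ⌈ p ⌉ ℤ.≤ z
↥p≤z*↧p⇒⌈p⌉≤z p z p≤z = begin
  ⌈ p ⌉             ≡⟨ ⌈p⌉≡-⌊-p⌋ p ⟩
  ℤ.- ⌊ ℚ.- p ⌋     ≤⟨ ℤ.neg-mono-≤ (z*↧p≤↥p⇒z≤⌊p⌋ (ℚ.- p) (ℤ.- z) -z≤-p) ⟩
  ℤ.- (ℤ.- z)       ≡⟨ ℤ.neg-involutive z ⟩
  z                 ∎
  where
  open ℤ.≤-Reasoning
  -z≤-p : ℤ.- z ℤ.* ↧ (ℚ.- p) ℤ.≤ ↥ (ℚ.- p)
  -z≤-p = begin
    ℤ.- z ℤ.* ↧ (ℚ.- p)  ≡⟨ cong (ℤ.- z ℤ.*_) (ℚ.↧-neg p) ⟩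
    ℤ.- z ℤ.* ↧ p        ≡⟨ ℤ.neg-distribˡ-* z (↧ p) ⟨
    ℤ.- (z ℤ.* ↧ p)      ≤⟨ ℤ.neg-mono-≤ p≤z ⟩
    ℤ.- ↥ p              ≡⟨ ℚ.↥-neg p ⟨
    ↥ (ℚ.- p)            ∎

↥p≤⌈p⌉*↧p : ∀ p → ↥ p ℤ.≤ ⌈ p ⌉ ℤ.* ↧ p
↥p≤⌈p⌉*↧p p = begin
  ↥ p                            ≡⟨ ℤ.neg-involutive (↥ p) ⟨
  ℤ.- (ℤ.- ↥ p)                  ≡⟨ cong ℤ.-_ (ℚ.↥-neg p) ⟨
  ℤ.- ↥ (ℚ.- p)                  ≤⟨ ℤ.neg-mono-≤ (⌊p⌋*↧p≤↥p (ℚ.- p)) ⟩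
  ℤ.- (⌊ ℚ.- p ⌋ ℤ.* ↧ (ℚ.- p))  ≡⟨ ℤ.neg-distribˡ-* ⌊ ℚ.- p ⌋ (↧ (ℚ.- p)) ⟩
  ℤ.- ⌊ ℚ.- p ⌋ ℤ.* ↧ (ℚ.- p)    ≡⟨ cong₂ ℤ._*_ (sym (⌈p⌉≡-⌊-p⌋ p)) (ℚ.↧-neg p) ⟩
  ⌈ p ⌉ ℤ.* ↧ p                  ∎
  where open ℤ.≤-Reasoning

*-swapʳ : ∀ i j k → i ℤ.* j ℤ.* k ≡ i ℤ.* k ℤ.* j
*-swapʳ i j k = trans (ℤ.*-assoc i j k)
  (trans (cong (i ℤ.*_) (ℤ.*-comm j k)) (sym (ℤ.*-assoc i k j)))

-- The next two lemmas bound the ceiling through any fraction a / (d + 1) that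
-- represents p, reduced or not.
⌈⌉-least : ∀ p {a d} z → toℚᵘ p ≃ᵘ mkℚᵘ a d → a ℤ.≤ z ℤ.* + suc d → ⌈ p ⌉ ℤ.≤ z
⌈⌉-least p@record{} {a} {d} z (*≡* eq) a≤zd = ↥p≤z*↧p⇒⌈p⌉≤z p z
  (ℤ.*-cancelʳ-≤-pos _ _ (+ suc d) (begin
    ↥ p ℤ.* + suc d           ≡⟨ eq ⟩
    a ℤ.* ↧ p                 ≤⟨ ℤ.*-monoʳ-≤-nonNeg (↧ p) a≤zd ⟩
    z ℤ.* + suc d ℤ.* ↧ p     ≡⟨ *-swapʳ z (+ suc d) (↧ p) ⟩
    z ℤ.* ↧ p ℤ.* + suc d     ∎))
  where open ℤ.≤-Reasoning

⌈⌉-upper : ∀ p {a d} → toℚᵘ p ≃ᵘ mkℚᵘ a d → a ℤ.≤ ⌈ p ⌉ ℤ.* + suc d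
⌈⌉-upper p@record{} {a} {d} (*≡* eq) = ℤ.*-cancelʳ-≤-pos _ _ (↧ p) (begin
  a ℤ.* ↧ p                   ≡⟨ eq ⟨
  ↥ p ℤ.* + suc d             ≤⟨ ℤ.*-monoʳ-≤-nonNeg (+ suc d) (↥p≤⌈p⌉*↧p p) ⟩
  ⌈ p ⌉ ℤ.* ↧ p ℤ.* + suc d   ≡⟨ *-swapʳ ⌈ p ⌉ (↧ p) (+ suc d) ⟩
  ⌈ p ⌉ ℤ.* + suc d ℤ.* ↧ p   ∎)
  where open ℤ.≤-Reasoning

k≤⌈k/2⌉*2 : ∀ k → k ≤ ⌈ k /2⌉ * 2
k≤⌈k/2⌉*2 k = begin
  k                    ≡⟨ ℕ.⌊n/2⌋+⌈n/2⌉≡n k ⟨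
  ⌊ k /2⌋ + ⌈ k /2⌉    ≤⟨ ℕ.+-monoˡ-≤ ⌈ k /2⌉ (ℕ.⌊n/2⌋≤⌈n/2⌉ k) ⟩
  ⌈ k /2⌉ + ⌈ k /2⌉    ≡⟨ solve 1 (λ x → x :+ x := x :* con 2) refl ⌈ k /2⌉ ⟩
  ⌈ k /2⌉ * 2          ∎
  where open ℕ.≤-Reasoning; open +-*-Solver

k≤l*2⇒⌈k/2⌉≤l : ∀ {k} l → k ≤ l * 2 → ⌈ k /2⌉ ≤ l
k≤l*2⇒⌈k/2⌉≤l {k} l k≤2l = begin
  ⌈ k /2⌉      ≤⟨ ℕ.⌈n/2⌉-mono k≤2l ⟩
  ⌈ l * 2 /2⌉  ≡⟨ cong ⌈_/2⌉ (solve 1 (λ x → x :* con 2 := x :+ x) refl l) ⟩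
  ⌈ l + l /2⌉  ≡⟨ ℕ.n≡⌈n+n/2⌉ l ⟨
  l            ∎
  where open ℕ.≤-Reasoning; open +-*-Solver

⌈+k/2⌉≡+⌈k/2⌉ : ∀ k → ⌈ + k / 2 ⌉ ≡ + ⌈ k /2⌉
⌈+k/2⌉≡+⌈k/2⌉ k = ℤ.≤-antisym
  (⌈⌉-least (+ k / 2) (+ ⌈ k /2⌉) k/2
    (subst (+ k ℤ.≤_) (ℤ.pos-* ⌈ k /2⌉ 2) (ℤ.+≤+ (k≤⌈k/2⌉*2 k))))
  (lower _ (⌈⌉-upper (+ k / 2) k/2))
  where
  k/2 : toℚᵘ (+ k / 2) ≃ᵘ mkℚᵘ (+ k) 1
  k/2 = ℚ.toℚᵘ-fromℚᵘ (mkℚᵘ (+ k) 1)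
  lower : ∀ z → + k ℤ.≤ z ℤ.* + 2 → + ⌈ k /2⌉ ℤ.≤ z
  lower (+ l) k≤2l = ℤ.+≤+ (k≤l*2⇒⌈k/2⌉≤l l
    (ℤ.drop‿+≤+ (subst (+ k ℤ.≤_) (sym (ℤ.pos-* l 2)) k≤2l)))
  lower -[1+ l ] ()

7w≤3k⇒⌈7w/6⌉≤⌈k/2⌉ : ∀ w k → 7 * w ≤ 3 * k →
  ⌈ (+ 7 / 6) ℚ.* (+ w / 1) ⌉ ℤ.≤ + ⌈ k /2⌉
7w≤3k⇒⌈7w/6⌉≤⌈k/2⌉ w k 7w≤3k = ⌈⌉-least ((+ 7 / 6) ℚ.* (+ w / 1)) (+ ⌈ k /2⌉) 7w/6
  (subst₂ ℤ._≤_ (ℤ.pos-* 7 w) (ℤ.pos-* ⌈ k /2⌉ 6) (ℤ.+≤+ (begin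
    7 * w                ≤⟨ 7w≤3k ⟩
    3 * k                ≤⟨ ℕ.*-monoʳ-≤ 3 (k≤⌈k/2⌉*2 k) ⟩
    3 * (⌈ k /2⌉ * 2)    ≡⟨ solve 1 (λ x → con 3 :* (x :* con 2) := x :* con 6) refl ⌈ k /2⌉ ⟩
    ⌈ k /2⌉ * 6          ∎)))
  where
  open ℕ.≤-Reasoning
  open +-*-Solver
  7w/6 : toℚᵘ ((+ 7 / 6) ℚ.* (+ w / 1)) ≃ᵘ mkℚᵘ (+ 7 ℤ.* + w) 5
  7w/6 = ℚᵘ.≃-trans (ℚ.toℚᵘ-homo-* (+ 7 / 6) (+ w / 1))
    (ℚᵘ.*-congˡ {mkℚᵘ (+ 7) 5} (ℚ.toℚᵘ-fromℚᵘ (mkℚᵘ (+ w) 0)))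

-- Finite sets

∣p∪q∣+∣p∩q∣≡∣p∣+∣q∣ : (p q : Subset n) → ∣ p ∪ q ∣ + ∣ p ∩ q ∣ ≡ ∣ p ∣ + ∣ q ∣
∣p∪q∣+∣p∩q∣≡∣p∣+∣q∣ []            []            = refl
∣p∪q∣+∣p∩q∣≡∣p∣+∣q∣ (outside ∷ p) (outside ∷ q) = ∣p∪q∣+∣p∩q∣≡∣p∣+∣q∣ p q
∣p∪q∣+∣p∩q∣≡∣p∣+∣q∣ (inside  ∷ p) (outside ∷ q) = cong suc (∣p∪q∣+∣p∩q∣≡∣p∣+∣q∣ p q)
∣p∪q∣+∣p∩q∣≡∣p∣+∣q∣ (outside ∷ p) (inside  ∷ q) =
  trans (cong suc (∣p∪q∣+∣p∩q∣≡∣p∣+∣q∣ p q)) (sym (ℕ.+-suc ∣ p ∣ ∣ q ∣))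
∣p∪q∣+∣p∩q∣≡∣p∣+∣q∣ (inside  ∷ p) (inside  ∷ q) = cong suc
  (trans (ℕ.+-suc ∣ p ∪ q ∣ ∣ p ∩ q ∣)
  (trans (cong suc (∣p∪q∣+∣p∩q∣≡∣p∣+∣q∣ p q)) (sym (ℕ.+-suc ∣ p ∣ ∣ q ∣))))

∣p∪q∣≤∣p∣+∣q∣ : (p q : Subset n) → ∣ p ∪ q ∣ ≤ ∣ p ∣ + ∣ q ∣
∣p∪q∣≤∣p∣+∣q∣ p q = subst (∣ p ∪ q ∣ ≤_) (∣p∪q∣+∣p∩q∣≡∣p∣+∣q∣ p q) (ℕ.m≤m+n _ _)

-- Disjointness, as emptiness of the intersection.
Disjoint : Subset n → Subset n → Set
Disjoint p q = Empty (p ∩ q)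

empty⇒∣p∣≡0 : {p : Subset n} → Empty p → ∣ p ∣ ≡ 0
empty⇒∣p∣≡0 {n} empty = trans (cong ∣_∣ (Empty-unique empty)) (∣⊥∣≡0 n)

nonempty⇒0<∣p∣ : {p : Subset n} → Nonempty p → 0 < ∣ p ∣
nonempty⇒0<∣p∣ {p = p} (v , v∈p) = subst (_≤ ∣ p ∣) (∣⁅x⁆∣≡1 v)
  (p⊆q⇒∣p∣≤∣q∣ λ u∈⁅v⁆ → subst (_∈ p) (sym (x∈⁅y⁆⇒x≡y v u∈⁅v⁆)) v∈p)

∣p∪q∣≡∣p∣+∣q∣ : (p q : Subset n) → Disjoint p q → ∣ p ∪ q ∣ ≡ ∣ p ∣ + ∣ q ∣
∣p∪q∣≡∣p∣+∣q∣ p q dis = begin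
  ∣ p ∪ q ∣                ≡⟨ ℕ.+-identityʳ _ ⟨
  ∣ p ∪ q ∣ + 0            ≡⟨ cong (λ k → ∣ p ∪ q ∣ + k) (empty⇒∣p∣≡0 dis) ⟨
  ∣ p ∪ q ∣ + ∣ p ∩ q ∣    ≡⟨ ∣p∪q∣+∣p∩q∣≡∣p∣+∣q∣ p q ⟩
  ∣ p ∣ + ∣ q ∣            ∎
  where open ≡-Reasoning

∣q∣<∣p∣⇒∃∈p∉q : (p q : Subset n) → ∣ q ∣ < ∣ p ∣ → ∃[ v ] (v ∈ p × v ∉ q)
∣q∣<∣p∣⇒∃∈p∉q p q ∣q∣<∣p∣ with any? (λ v → v ∈? p ×-dec ¬? (v ∈? q))
... | yes found = found
... | no  none  = contradiction (p⊆q⇒∣p∣≤∣q∣ p⊆q) (ℕ.<⇒≱ ∣q∣<∣p∣)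
  where
  p⊆q : p ⊆ q
  p⊆q {v} v∈p = decidable-stable (v ∈? q) λ v∉q → none (v , v∈p , v∉q)

∩-nonempty-sym : {p q : Subset n} → Nonempty (p ∩ q) → Nonempty (q ∩ p)
∩-nonempty-sym {p = p} {q} (v , v∈) =
  let v∈p , v∈q = x∈p∩q⁻ p q v∈ in v , x∈p∩q⁺ (v∈q , v∈p)

overfull⇒meet : {p q r : Subset n} → p ⊆ r → q ⊆ r → ∣ r ∣ < ∣ p ∣ + ∣ q ∣ → Nonempty (p ∩ q)
overfull⇒meet {p = p} {q} {r} p⊆r q⊆r ∣r∣<∣p∣+∣q∣ = decidable-stable (nonempty? (p ∩ q)) λ dis →
  ℕ.<⇒≱ ∣r∣<∣p∣+∣q∣ (begin
    ∣ p ∣ + ∣ q ∣  ≡⟨ ∣p∪q∣≡∣p∣+∣q∣ p q dis ⟨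
    ∣ p ∪ q ∣      ≤⟨ p⊆q⇒∣p∣≤∣q∣ ([ p⊆r , q⊆r ]′ ∘ x∈p∪q⁻ p q) ⟩
    ∣ r ∣          ∎)
  where open ℕ.≤-Reasoning

-- An enumeration of all subsets of Fin n.
subsets : ∀ n → List (Subset n)
subsets zero    = [] ∷ []
subsets (suc n) = map (inside ∷_) (subsets n) ++ map (outside ∷_) (subsets n)

∈-subsets : (p : Subset n) → p ∈ˡ subsets n
∈-subsets []            = here refl
∈-subsets (inside  ∷ p) = ∈-++⁺ˡ (∈-map⁺ (inside ∷_) (∈-subsets p))
∈-subsets (outside ∷ p) = ∈-++⁺ʳ (map (inside ∷_) (subsets _)) (∈-map⁺ (outside ∷_) (∈-subsets p))

foldr-∩-⊆ : ∀ p (qs : List (Subset n)) → foldr _∩_ p qs ⊆ p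
foldr-∩-⊆ p []       = id
foldr-∩-⊆ p (q ∷ qs) = foldr-∩-⊆ p qs ∘ p∩q⊆q q _

foldr-∩-⊆-∈ : ∀ {p q} {qs : List (Subset n)} → q ∈ˡ qs → foldr _∩_ p qs ⊆ q
foldr-∩-⊆-∈ (here refl)              = p∩q⊆p _ _
foldr-∩-⊆-∈ {qs = r ∷ _} (there q∈) = foldr-∩-⊆-∈ q∈ ∘ p∩q⊆q r _

-- The image of a subset under a function.
image : (Fin m → Fin n) → Subset m → Subset n
image f []            = ⊥
image f (outside ∷ p) = image (f ∘ suc) p
image f (inside  ∷ p) = ⁅ f zero ⁆ ∪ image (f ∘ suc) p

∈-image⁻ : ∀ (f : Fin m → Fin n) p {v} → v ∈ image f p → ∃[ i ] (i ∈ p × f i ≡ v)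
∈-image⁻ f []            v∈ = contradiction v∈ ∉⊥
∈-image⁻ f (outside ∷ p) v∈ =
  let i , i∈p , fi≡v = ∈-image⁻ (f ∘ suc) p v∈ in suc i , Vec.there i∈p , fi≡v
∈-image⁻ f (inside  ∷ p) v∈ with x∈p∪q⁻ ⁅ f zero ⁆ _ v∈
... | inj₁ v∈⁅f0⁆ = zero , Vec.here , sym (x∈⁅y⁆⇒x≡y _ v∈⁅f0⁆)
... | inj₂ v∈     =
  let i , i∈p , fi≡v = ∈-image⁻ (f ∘ suc) p v∈ in suc i , Vec.there i∈p , fi≡v

∣image∣ : ∀ (f : Fin m → Fin n) → Injective _≡_ _≡_ f → ∀ p → ∣ image f p ∣ ≡ ∣ p ∣
∣image∣ {n = n} f inj []    = ∣⊥∣≡0 n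
∣image∣ f inj (outside ∷ p) = ∣image∣ (f ∘ suc) (Fin.suc-injective ∘ inj) p
∣image∣ f inj (inside  ∷ p) = trans
  (∣p∪q∣≡∣p∣+∣q∣ ⁅ f zero ⁆ (image (f ∘ suc) p) disjoint)
  (cong₂ _+_ (∣⁅x⁆∣≡1 (f zero)) (∣image∣ (f ∘ suc) (Fin.suc-injective ∘ inj) p))
  where
  disjoint : Disjoint ⁅ f zero ⁆ (image (f ∘ suc) p)
  disjoint (v , v∈) with x∈p∩q⁻ ⁅ f zero ⁆ _ v∈
  ... | v∈⁅f0⁆ , v∈image with ∈-image⁻ (f ∘ suc) p v∈image
  ... | i , _ , fi≡v with inj (trans fi≡v (x∈⁅y⁆⇒x≡y (f zero) v∈⁅f0⁆))
  ... | ()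

-- An injection that maps p into q and misses an element of q.
image-< : ∀ (f : Fin m → Fin n) → Injective _≡_ _≡_ f → ∀ {p q v} →
  (∀ {i} → i ∈ p → f i ∈ q) → v ∈ q → (∀ i → f i ≢ v) → ∣ p ∣ < ∣ q ∣
image-< f inj {p} {q} {v} p⇒q v∈q missed = subst (_< ∣ q ∣) (∣image∣ f inj p) (p⊂q⇒∣p∣<∣q∣
  ( (λ u∈ → let i , i∈p , fi≡u = ∈-image⁻ f p u∈ in subst (_∈ q) fi≡u (p⇒q i∈p))
  , v , v∈q , λ v∈ → let i , _ , fi≡v = ∈-image⁻ f p v∈ in missed i fi≡v ))

lookup-injective : ∀ {A : Set} {xs : List A} → Unique xs → Injective _≡_ _≡_ (lookup xs)
lookup-injective (_ ∷ _)   {zero}  {zero}  _  = refl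
lookup-injective (x∉ ∷ _)  {zero}  {suc j} eq = contradiction eq (All.lookup x∉ (∈-lookup j))
lookup-injective (x∉ ∷ _)  {suc i} {zero}  eq = contradiction (sym eq) (All.lookup x∉ (∈-lookup i))
lookup-injective (_ ∷ xs!) {suc i} {suc j} eq = cong suc (lookup-injective xs! eq)

∈-neighbours⁺ : (G : Graph n) → ∀ {u v} → Adj G u v → v ∈ neighbours G u
∈-neighbours⁺ G {u} {v} uv = lookup⇒[]= v _
  (trans (lookup∘tabulate (does ∘ adj? G u) v) (dec-true (adj? G u v) uv))

∈-neighbours⁻ : (G : Graph n) → ∀ {u v} → v ∈ neighbours G u → Adj G u v
∈-neighbours⁻ G {u} {v} v∈N
  with adj? G u v | trans (sym (lookup∘tabulate (does ∘ adj? G u) v)) ([]=⇒lookup v∈N)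
... | yes uv | _ = uv
... | no _   | ()

-- Independent transversals

-- The graph G without those edges that touch W and are not listed in L (in
-- either orientation).
restrict : Graph n → Subset n → List (Fin n × Fin n) → Graph n
restrict G W L = record
  { Adj     = λ u v → Adj G u v × ((u ∉ W × v ∉ W) ⊎ (u , v) ∈ˡ L ⊎ (v , u) ∈ˡ L)
  ; adj?    = λ u v → adj? G u v ×-dec
      ((¬? (u ∈? W) ×-dec ¬? (v ∈? W)) ⊎-dec ((u , v) ∈ˡ? L) ⊎-dec ((v , u) ∈ˡ? L))
  ; adj-sym = λ { (uv , inj₁ (u∉W , v∉W)) → adj-sym G uv , inj₁ (v∉W , u∉W)
                ; (uv , inj₂ (inj₁ ∈L))   → adj-sym G uv , inj₂ (inj₂ ∈L)
                ; (uv , inj₂ (inj₂ ∈L))   → adj-sym G uv , inj₂ (inj₁ ∈L) }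
  ; irrefl  = λ u≡v → irrefl G u≡v ∘ proj₁
  }
  where open DecMembership (Product.≡-dec _≟ᶠ_ _≟ᶠ_) using () renaming (_∈?_ to _∈ˡ?_)

-- The parts are subsets V i with labels i in an arbitrary type; a list Q of
-- labels says which parts are under consideration.  The number d bounds the
-- degrees.
module IndependentTransversals
  {n : ℕ} {I : Set} (_≟_ : DecidableEquality I) (V : I → Subset n) (d : ℕ) where

  -- An independent transversal of the parts in Q that avoids the removed set X.
  -- Only the values of pick at labels in Q matter.
  record Transversal (G : Graph n) (X : Subset n) (Q : List I) : Set where
    field
      pick    : I → Fin n
      in-part : ∀ {i} → i ∈ˡ Q → pick i ∈ V i
      avoids  : ∀ {i} → i ∈ˡ Q → pick i ∉ X
      indep   : ∀ {i j} → i ∈ˡ Q → j ∈ˡ Q → ¬ Adj G (pick i) (pick j)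
  open Transversal

  -- An independent transversal of the parts in Q together with the root part W.
  record Rooted (G : Graph n) (W X : Subset n) (Q : List I) : Set where
    field
      rest       : Transversal G X Q
      root       : Fin n
      root∈W     : root ∈ W
      root∉X     : root ∉ X
      root-indep : ∀ {i} → i ∈ˡ Q → ¬ Adj G root (pick rest i)
  open Rooted

  -- The hypotheses of Haxell's theorem: disjoint parts of size at least 2 d and
  -- degrees at most d.  There is no lower bound on the size of the root part W.
  record Admissible (G : Graph n) (W : Subset n) (Q : List I) : Set where
    field
      root-disjoint : ∀ {i} → i ∈ˡ Q → Disjoint W (V i)
      disjoint      : ∀ {i j} → i ∈ˡ Q → j ∈ˡ Q → i ≢ j → Disjoint (V i) (V j)
      large         : ∀ {i} → i ∈ˡ Q → d + d ≤ ∣ V i ∣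
      root-degree   : ∀ {v} → v ∈ W → degree G v ≤ d
      part-degree   : ∀ {i v} → i ∈ˡ Q → v ∈ V i → degree G v ≤ d
  open Admissible

  admissible-⊆ : ∀ {G H : Graph n} {W Q} →
    (∀ {u v} → Adj H u v → Adj G u v) → Admissible G W Q → Admissible H W Q
  admissible-⊆ {G} {H} H⊆G adm = record
    { root-disjoint = root-disjoint adm
    ; disjoint      = disjoint adm
    ; large         = large adm
    ; root-degree   = λ v∈W → ≤-trans degree-≤ (root-degree adm v∈W)
    ; part-degree   = λ i∈Q v∈Vi → ≤-trans degree-≤ (part-degree adm i∈Q v∈Vi)
    }
    where
    degree-≤ : ∀ {v} → degree H v ≤ degree G v
    degree-≤ = p⊆q⇒∣p∣≤∣q∣ (∈-neighbours⁺ G ∘ H⊆G ∘ ∈-neighbours⁻ H)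

  -- The rooted form of Haxell's theorem for the parts in Q.  The condition that
  -- X is smaller than W is the one that survives merging a part into W.
  Extends : List I → Set₁
  Extends Q = ∀ {G W X} → Admissible G W Q → ∣ X ∣ < ∣ W ∣ → Transversal G X Q → Rooted G W X Q

  -- The labels in Q other than i.
  _∖_ : List I → I → List I
  Q ∖ i = filter (λ j → ¬? (j ≟ i)) Q

  -- The value z at the label i and the value v at every other label j.
  override : ∀ {i j : I} → Dec (j ≡ i) → Fin n → Fin n → Fin n
  override (yes _) z v = z
  override (no  _) z v = v

  override-elim : ∀ {i j : I} {z v} (P : Fin n → Set) (j≟i : Dec (j ≡ i)) →
    (j ≡ i → P z) → (j ≢ i → P v) → P (override j≟i z v)
  override-elim P (yes j≡i) Pz Pv = Pz j≡i
  override-elim P (no  j≢i) Pz Pv = Pv j≢i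

  -- The vertex z becomes the pick at the label i.
  insert : ∀ {G : Graph n} {X X′ Q Q′ i z} (T : Transversal G X′ Q′) → X ⊆ X′ →
    (∀ {j} → j ∈ˡ Q → j ≢ i → j ∈ˡ Q′) → z ∈ V i → z ∉ X →
    (∀ {j} → j ∈ˡ Q′ → ¬ Adj G z (pick T j)) → Transversal G X Q
  insert {G} {X} {i = i} {z} T X⊆X′ ∈Q′⁺ z∈Vi z∉X z-indep = record
    { pick    = λ j → override (j ≟ i) z (pick T j)
    ; in-part = λ {j} j∈Q → override-elim (_∈ V j) (j ≟ i)
        (λ { refl → z∈Vi }) (λ j≢i → in-part T (∈Q′⁺ j∈Q j≢i))
    ; avoids  = λ {j} j∈Q → override-elim (_∉ X) (j ≟ i)
        (λ _ → z∉X) (λ j≢i → avoids T (∈Q′⁺ j∈Q j≢i) ∘ X⊆X′)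
    ; indep   = λ {j} {k} j∈Q k∈Q → override-elim (λ u → ¬ Adj G u _) (j ≟ i)
        (λ _ → override-elim (λ v → ¬ Adj G z v) (k ≟ i)
          (λ _ → irrefl G refl)
          (λ k≢i → z-indep (∈Q′⁺ k∈Q k≢i)))
        (λ j≢i → override-elim (λ v → ¬ Adj G (pick T j) v) (k ≟ i)
          (λ _ → z-indep (∈Q′⁺ j∈Q j≢i) ∘ adj-sym G)
          (λ k≢i → indep T (∈Q′⁺ j∈Q j≢i) (∈Q′⁺ k∈Q k≢i)))
    }

  -- The merging step.  The vertex x of W conflicts with the transversal M at
  -- most at the label i.
  module _ {G : Graph n} {W X : Subset n} {Q : List I}
    (adm : Admissible G W Q) (∣X∣<∣W∣ : ∣ X ∣ < ∣ W ∣) (M : Transversal G X Q)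
    {x : Fin n} (x∈W : x ∈ W) (x∉X : x ∉ X) {i : I} (i∈Q : i ∈ˡ Q)
    (only : ∀ {j} → j ∈ˡ Q → j ≢ i → ¬ Adj G x (pick M j)) where

    private
      y  = pick M i
      N  = neighbours G x ∪ neighbours G y
      W′ = W ∪ V i
      X′ = X ∪ N
      Q′ = Q ∖ i

      ∈Q′⁺ : ∀ {j} → j ∈ˡ Q → j ≢ i → j ∈ˡ Q′
      ∈Q′⁺ = ∈-filter⁺ (λ j → ¬? (j ≟ i))

      ∈Q′⁻ : ∀ {j} → j ∈ˡ Q′ → j ∈ˡ Q × j ≢ i
      ∈Q′⁻ = ∈-filter⁻ (λ j → ¬? (j ≟ i))

      ∉X′⁻ : ∀ {v} → v ∉ X′ → v ∉ X × ¬ Adj G x v × ¬ Adj G y v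
      ∉X′⁻ v∉ = v∉ ∘ p⊆p∪q N
              , v∉ ∘ q⊆p∪q X N ∘ p⊆p∪q _ ∘ ∈-neighbours⁺ G
              , v∉ ∘ q⊆p∪q X N ∘ q⊆p∪q (neighbours G x) _ ∘ ∈-neighbours⁺ G

      admissible′ : Admissible G W′ Q′
      admissible′ = record
        { root-disjoint = λ { {j} j∈Q′ (v , v∈) →
            let j∈Q , j≢i = ∈Q′⁻ j∈Q′
                v∈W′ , v∈Vj = x∈p∩q⁻ W′ (V j) v∈
            in [ (λ v∈W → root-disjoint adm j∈Q (v , x∈p∩q⁺ (v∈W , v∈Vj)))
               , (λ v∈Vi → disjoint adm i∈Q j∈Q (j≢i ∘ sym) (v , x∈p∩q⁺ (v∈Vi , v∈Vj)))
               ]′ (x∈p∪q⁻ W (V i) v∈W′) }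
        ; disjoint      = λ j∈ k∈ → disjoint adm (proj₁ (∈Q′⁻ j∈)) (proj₁ (∈Q′⁻ k∈))
        ; large         = large adm ∘ proj₁ ∘ ∈Q′⁻
        ; root-degree   = [ root-degree adm , part-degree adm i∈Q ]′ ∘ x∈p∪q⁻ W (V i)
        ; part-degree   = part-degree adm ∘ proj₁ ∘ ∈Q′⁻
        }

      ∣X′∣<∣W′∣ : ∣ X′ ∣ < ∣ W′ ∣
      ∣X′∣<∣W′∣ = begin-strict
        ∣ X′ ∣                              ≤⟨ ∣p∪q∣≤∣p∣+∣q∣ X N ⟩
        ∣ X ∣ + ∣ N ∣                       ≤⟨ ℕ.+-monoʳ-≤ ∣ X ∣ (∣p∪q∣≤∣p∣+∣q∣ (neighbours G x) _) ⟩
        ∣ X ∣ + (degree G x + degree G y)   ≤⟨ ℕ.+-monoʳ-≤ ∣ X ∣ (ℕ.+-mono-≤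
                                                 (root-degree adm x∈W)
                                                 (part-degree adm i∈Q (in-part M i∈Q))) ⟩
        ∣ X ∣ + (d + d)                     <⟨ ℕ.+-mono-<-≤ ∣X∣<∣W∣ (large adm i∈Q) ⟩
        ∣ W ∣ + ∣ V i ∣                     ≡⟨ ∣p∪q∣≡∣p∣+∣q∣ W (V i) (root-disjoint adm i∈Q) ⟨
        ∣ W′ ∣                              ∎
        where open ℕ.≤-Reasoning

      M′ : Transversal G X′ Q′
      M′ = record
        { pick    = pick M
        ; in-part = in-part M ∘ proj₁ ∘ ∈Q′⁻
        ; avoids  = λ j∈ v∈ → let j∈Q , j≢i = ∈Q′⁻ j∈ in
            [ avoids M j∈Q
            , [ only j∈Q j≢i ∘ ∈-neighbours⁻ G
              , indep M i∈Q j∈Q ∘ ∈-neighbours⁻ G ]′ ∘ x∈p∪q⁻ (neighbours G x) _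
            ]′ (x∈p∪q⁻ X N v∈)
        ; indep   = λ j∈ k∈ → indep M (proj₁ (∈Q′⁻ j∈)) (proj₁ (∈Q′⁻ k∈))
        }

      insert-rooted : (T : Transversal G X′ Q′) → ∀ {z} → z ∈ V i → z ∉ X →
        (∀ {j} → j ∈ˡ Q′ → ¬ Adj G z (pick T j)) →
        ∀ {r} → r ∈ W → r ∉ X → ¬ Adj G r z →
        (∀ {j} → j ∈ˡ Q′ → ¬ Adj G r (pick T j)) → Rooted G W X Q
      insert-rooted T z∈Vi z∉X z-indep {r} r∈W r∉X rz r-indep = record
        { rest       = insert T (p⊆p∪q N) ∈Q′⁺ z∈Vi z∉X z-indep
        ; root       = r
        ; root∈W     = r∈W
        ; root∉X     = r∉X
        ; root-indep = λ {j} j∈Q → override-elim (λ v → ¬ Adj G r v) (j ≟ i)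
            (λ _ → rz) (λ j≢i → r-indep (∈Q′⁺ j∈Q j≢i))
        }

    merge : Extends (Q ∖ i) → Rooted G W X Q
    merge extends with extends admissible′ ∣X′∣<∣W′∣ M′
    ... | record { rest = T ; root = r ; root∈W = r∈W′ ; root∉X = r∉X′ ; root-indep = r-indep }
      with ∉X′⁻ r∉X′ | x∈p∪q⁻ W _ r∈W′
    -- The new root r lies in W, and y represents the part V i.
    ... | r∉X , ¬xr , ¬yr | inj₁ r∈W  = insert-rooted T (in-part M i∈Q) (avoids M i∈Q)
      (λ j∈ → proj₂ (proj₂ (∉X′⁻ (avoids T j∈)))) r∈W r∉X (¬yr ∘ adj-sym G) r-indep
    -- The new root r represents the part V i, and x is the root.
    ... | r∉X , ¬xr , ¬yr | inj₂ r∈Vi = insert-rooted T r∈Vi r∉X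
      r-indep x∈W x∉X ¬xr (λ j∈ → proj₁ (proj₂ (∉X′⁻ (avoids T j∈))))

  module _ {Q : List I} (smaller : ∀ {i} → i ∈ˡ Q → Extends (Q ∖ i)) where

    module _ {G : Graph n} {W X : Subset n}
      (adm : Admissible G W Q) (∣X∣<∣W∣ : ∣ X ∣ < ∣ W ∣) (M : Transversal G X Q) where

      private
        outside-W : ∀ {i v} → i ∈ˡ Q → v ∈ V i → v ∉ W
        outside-W i∈Q v∈Vi v∈W = root-disjoint adm i∈Q (_ , x∈p∩q⁺ (v∈W , v∈Vi))

      -- A rooted transversal exists when only the edges at W listed in L are
      -- present, by induction on L.
      sweep : ∀ L → Rooted (restrict G W L) W X Q
      sweep [] = let w , w∈W , w∉X = ∣q∣<∣p∣⇒∃∈p∉q W X ∣X∣<∣W∣ in record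
        { rest = record
            { pick    = pick M
            ; in-part = in-part M
            ; avoids  = avoids M
            ; indep   = λ i∈Q j∈Q → indep M i∈Q j∈Q ∘ proj₁
            }
        ; root       = w
        ; root∈W     = w∈W
        ; root∉X     = w∉X
        ; root-indep = λ { _ (_ , inj₁ (w∉W , _)) → w∉W w∈W
                         ; _ (_ , inj₂ (inj₁ ()))
                         ; _ (_ , inj₂ (inj₂ ())) }
        }
      sweep (e ∷ L) = decide (Any.any? (λ i → adj? G₊ x (pick T i)) Q)
        where
        open Rooted (sweep L) renaming
          (rest to T; root to x; root∈W to x∈W; root∉X to x∉X; root-indep to x-indep)
        G₊ = restrict G W (e ∷ L)

        -- The picks lie outside W, so they are unaffected by the edge e.
        T₊ : Transversal G₊ X Q
        T₊ = record
          { pick    = pick T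
          ; in-part = in-part T
          ; avoids  = avoids T
          ; indep   = λ i∈Q j∈Q ij → indep T i∈Q j∈Q (proj₁ ij ,
              inj₁ (outside-W i∈Q (in-part T i∈Q) , outside-W j∈Q (in-part T j∈Q)))
          }

        conflict-is-e : ∀ {i} → i ∈ˡ Q → Adj G₊ x (pick T i) →
          e ≡ (x , pick T i) ⊎ e ≡ (pick T i , x)
        conflict-is-e i∈Q (_  , inj₁ (x∉W , _))        = contradiction x∈W x∉W
        conflict-is-e i∈Q (_  , inj₂ (inj₁ (here eq))) = inj₁ (sym eq)
        conflict-is-e i∈Q (_  , inj₂ (inj₂ (here eq))) = inj₂ (sym eq)
        conflict-is-e i∈Q (xv , inj₂ (inj₁ (there ∈L))) =
          contradiction (xv , inj₂ (inj₁ ∈L)) (x-indep i∈Q)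
        conflict-is-e i∈Q (xv , inj₂ (inj₂ (there ∈L))) =
          contradiction (xv , inj₂ (inj₂ ∈L)) (x-indep i∈Q)

        other-end-unique : ∀ {u v : Fin n} →
          e ≡ (x , u) ⊎ e ≡ (u , x) → e ≡ (x , v) ⊎ e ≡ (v , x) → u ≡ v
        other-end-unique (inj₁ refl) (inj₁ refl) = refl
        other-end-unique (inj₁ refl) (inj₂ refl) = refl
        other-end-unique (inj₂ refl) (inj₁ refl) = refl
        other-end-unique (inj₂ refl) (inj₂ refl) = refl

        decide : Dec (Any (λ i → Adj G₊ x (pick T i)) Q) → Rooted G₊ W X Q
        decide (no none) = record
          { rest       = T₊
          ; root       = x
          ; root∈W     = x∈W
          ; root∉X     = x∉X
          ; root-indep = λ i∈Q xi → none (lose i∈Q xi)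
          }
        decide (yes some) = let i , i∈Q , xi = find some in
          merge (admissible-⊆ proj₁ adm) ∣X∣<∣W∣ T₊ x∈W x∉X i∈Q
            (λ {j} j∈Q j≢i xj →
              let picks≡ = other-end-unique (conflict-is-e i∈Q xi) (conflict-is-e j∈Q xj)
              in disjoint adm j∈Q i∈Q j≢i
                   (_ , x∈p∩q⁺ (in-part T j∈Q , subst (_∈ V i) picks≡ (in-part T i∈Q))))
            (smaller i∈Q)

    extends-step : Extends Q
    extends-step {G} {W} {X} adm ∣X∣<∣W∣ M = record
      { rest = record
          { pick    = pick (rest R)
          ; in-part = in-part (rest R)
          ; avoids  = avoids (rest R)
          ; indep   = λ i∈Q j∈Q → indep (rest R) i∈Q j∈Q ∘ all-listed
          }
      ; root       = root R
      ; root∈W     = root∈W R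
      ; root∉X     = root∉X R
      ; root-indep = λ i∈Q → root-indep R i∈Q ∘ all-listed
      }
      where
      pairs = cartesianProduct (allFin n) (allFin n)
      R = sweep adm ∣X∣<∣W∣ M pairs
      all-listed : ∀ {u v} → Adj G u v → Adj (restrict G W pairs) u v
      all-listed {u} {v} uv = uv , inj₂ (inj₁ (∈-cartesianProduct⁺ (∈-allFin u) (∈-allFin v)))

  extends : ∀ k {Q} → length Q < k → Extends Q
  extends (suc k) {Q} (s≤s ∣Q∣≤k) = extends-step λ {i} i∈Q → extends k (≤-trans
    (filter-notAll (λ j → ¬? (j ≟ i)) Q (Any.map (λ { refl ¬i≡i → ¬i≡i refl }) i∈Q)) ∣Q∣≤k)

  -- Haxell's theorem.  The root part is taken empty in the hypothesis, and the
  -- vertex v₀ is only the irrelevant value of pick on the empty list.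
  independent-transversal : Fin n → ∀ {G : Graph n} {Q} → Admissible G ⊥ Q →
    (∀ {i} → i ∈ˡ Q → Nonempty (V i)) → Transversal G ⊥ Q
  independent-transversal v₀ {G} {[]} adm inhabited = record
    { pick = λ _ → v₀ ; in-part = λ () ; avoids = λ () ; indep = λ () }
  independent-transversal v₀ {G} {i ∷ Q} adm inhabited = cons (i ∈ˡ? Q)
    where
    open DecMembership _≟_ using () renaming (_∈?_ to _∈ˡ?_)
    T : Transversal G ⊥ Q
    T = independent-transversal v₀ record
      { root-disjoint = root-disjoint adm ∘ there
      ; disjoint      = λ j∈Q k∈Q → disjoint adm (there j∈Q) (there k∈Q)
      ; large         = large adm ∘ there
      ; root-degree   = root-degree adm
      ; part-degree   = part-degree adm ∘ there
      } (inhabited ∘ there)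
    cons : Dec (i ∈ˡ Q) → Transversal G ⊥ (i ∷ Q)
    cons (yes i∈Q) = record
      { pick    = pick T
      ; in-part = in-part T ∘ drop
      ; avoids  = avoids T ∘ drop
      ; indep   = λ j∈ k∈ → indep T (drop j∈) (drop k∈)
      }
      where
      drop : ∀ {j} → j ∈ˡ i ∷ Q → j ∈ˡ Q
      drop (here refl) = i∈Q
      drop (there j∈Q) = j∈Q
    cons (no i∉Q) = insert (rest R) id
      (λ { (here j≡i) j≢i → contradiction j≡i j≢i ; (there j∈Q) _ → j∈Q })
      (root∈W R) (root∉X R) (root-indep R)
      where
      R : Rooted G (V i) ⊥ Q
      R = extends (suc (length Q)) ≤-refl record
        { root-disjoint = λ j∈Q → disjoint adm (here refl) (there j∈Q) λ { refl → i∉Q j∈Q }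
        ; disjoint      = λ j∈Q k∈Q → disjoint adm (there j∈Q) (there k∈Q)
        ; large         = large adm ∘ there
        ; root-degree   = part-degree adm (here refl)
        ; part-degree   = part-degree adm ∘ there
        }
        (subst (_< ∣ V i ∣) (sym (∣⊥∣≡0 n)) (nonempty⇒0<∣p∣ (inhabited (here refl)))) T

-- Arithmetic of clique sizes

-- In the next three lemmas w stands for the clique number and s for the maximum
-- degree plus one.  The first one is the counting in Hajnal's inequality: d and
-- f are the sizes of the old intersection and union, b and c those of the new
-- ones, and a is the number of vertices of the new clique in the old union.
exchange : ∀ {w d f a b c} → w + w ≤ d + f → a + d ≤ w + b → c + a ≡ w + f → w + w ≤ b + c
exchange {w} {d} {f} {a} {b} {c} 2w≤d+f a+d≤w+b c+a≡w+f = ℕ.+-cancelʳ-≤ (a + w) _ _ (begin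
  (w + w) + (a + w)  ≤⟨ ℕ.+-monoˡ-≤ (a + w) 2w≤d+f ⟩
  (d + f) + (a + w)  ≡⟨ solve 4 (λ d f a w → (d :+ f) :+ (a :+ w) := (a :+ d) :+ (w :+ f)) refl d f a w ⟩
  (a + d) + (w + f)  ≤⟨ ℕ.+-mono-≤ a+d≤w+b (ℕ.≤-reflexive (sym c+a≡w+f)) ⟩
  (w + b) + (c + a)  ≡⟨ solve 4 (λ w b c a → (w :+ b) :+ (c :+ a) := (b :+ c) :+ (a :+ w)) refl w b c a ⟩
  (b + c) + (a + w)  ∎)
  where open ℕ.≤-Reasoning; open +-*-Solver

-- If 3 s ≤ 4 w, two numbers that are at least 2 w - s add up to more than w.
overfull : ∀ {w s a b} → 0 < s → 3 * s ≤ 4 * w → w + w ≤ a + s → w + w ≤ b + s → w < a + b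
overfull {w} {s} {a} {b} 0<s dense 2w≤a+s 2w≤b+s = ℕ.≰⇒> λ a+b≤w →
  ℕ.<⇒≱ 2s<3w (ℕ.+-cancelʳ-≤ w _ _ (begin
    3 * w + w             ≡⟨ solve 1 (λ w → con 3 :* w :+ w := (w :+ w) :+ (w :+ w)) refl w ⟩
    (w + w) + (w + w)     ≤⟨ ℕ.+-mono-≤ 2w≤a+s 2w≤b+s ⟩
    (a + s) + (b + s)     ≡⟨ solve 3 (λ a b s → (a :+ s) :+ (b :+ s) := con 2 :* s :+ (a :+ b)) refl a b s ⟩
    2 * s + (a + b)       ≤⟨ ℕ.+-monoʳ-≤ (2 * s) a+b≤w ⟩
    2 * s + w             ∎))
  where
  open ℕ.≤-Reasoning
  open +-*-Solver
  2s<3w : 2 * s < 3 * w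
  2s<3w = ℕ.*-cancelˡ-< 4 _ _ (begin-strict
    4 * (2 * s)       <⟨ ℕ.m<n+m (4 * (2 * s)) 0<s ⟩
    s + 4 * (2 * s)   ≡⟨ solve 1 (λ s → s :+ con 4 :* (con 2 :* s) := con 3 :* (con 3 :* s)) refl s ⟩
    3 * (3 * s)       ≤⟨ ℕ.*-monoʳ-≤ 3 dense ⟩
    3 * (4 * w)       ≡⟨ solve 1 (λ w → con 3 :* (con 4 :* w) := con 4 :* (con 3 :* w)) refl w ⟩
    4 * (3 * w)       ∎)

-- If 3 s ≤ 4 w, a number that is at least 2 w - s is at least 2 (s - w).
roomy : ∀ {w s d c} → d + w ≡ s → 3 * s ≤ 4 * w → w + w ≤ c + s → d + d ≤ c
roomy {w} {s} {d} {c} d+w≡s dense 2w≤c+s = ℕ.+-cancelʳ-≤ (w + w + s) _ _ (begin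
  d + d + (w + w + s)     ≡⟨ solve 3 (λ d w s → d :+ d :+ (w :+ w :+ s) := (d :+ w) :+ (d :+ w) :+ s) refl d w s ⟩
  (d + w) + (d + w) + s   ≡⟨ cong (λ t → t + t + s) d+w≡s ⟩
  s + s + s               ≡⟨ solve 1 (λ s → s :+ s :+ s := con 3 :* s) refl s ⟩
  3 * s                   ≤⟨ dense ⟩
  4 * w                   ≡⟨ solve 1 (λ w → con 4 :* w := (w :+ w) :+ (w :+ w)) refl w ⟩
  (w + w) + (w + w)       ≤⟨ ℕ.+-monoˡ-≤ (w + w) 2w≤c+s ⟩
  c + s + (w + w)         ≡⟨ solve 3 (λ c s w → c :+ s :+ (w :+ w) := c :+ (w :+ w :+ s)) refl c s w ⟩
  c + (w + w + s)         ∎)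
  where open ℕ.≤-Reasoning; open +-*-Solver

-- Maximum cliques

module _ (G : Graph n) where

  -- Cliques with the largest possible number of vertices.
  IsMaximum : Subset n → Set
  IsMaximum C = IsClique G C × ∣ C ∣ ≡ ω G

  isMaximum? : ∀ C → Dec (IsMaximum C)
  isMaximum? C = isClique? G C ×-dec ∣ C ∣ ℕ.≟ ω G

  closed-neighbourhood-bound : ∀ {v} F → (∀ {u} → u ∈ F → v ≢ u → Adj G v u) → ∣ F ∣ ≤ suc (Δ G)
  closed-neighbourhood-bound {v} F adjacent = begin
    ∣ F ∣                          ≤⟨ p⊆q⇒∣p∣≤∣q∣ F⊆N[v] ⟩
    ∣ ⁅ v ⁆ ∪ neighbours G v ∣     ≤⟨ ∣p∪q∣≤∣p∣+∣q∣ ⁅ v ⁆ (neighbours G v) ⟩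
    ∣ ⁅ v ⁆ ∣ + degree G v         ≡⟨ cong (_+ degree G v) (∣⁅x⁆∣≡1 v) ⟩
    suc (degree G v)               ≤⟨ s≤s (degree≤Δ G v) ⟩
    suc (Δ G)                      ∎
    where
    open ℕ.≤-Reasoning
    F⊆N[v] : F ⊆ ⁅ v ⁆ ∪ neighbours G v
    F⊆N[v] {u} u∈F with v ≟ᶠ u
    ... | yes refl = x∈p∪q⁺ (inj₁ (x∈⁅x⁆ v))
    ... | no  v≢u  = x∈p∪q⁺ (inj₂ (∈-neighbours⁺ G (adjacent u∈F v≢u)))

  ω≤1+Δ : ω G ≤ suc (Δ G)
  ω≤1+Δ with ω-clique G
  ... | C , clique , ∣C∣≡ω with nonempty? C
  ...   | yes (v , v∈C) = subst (_≤ suc (Δ G)) ∣C∣≡ω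
            (closed-neighbourhood-bound {v} C λ u∈C v≢u → clique _ _ v∈C u∈C v≢u)
  ...   | no  empty     = subst (_≤ suc (Δ G)) (trans (sym (empty⇒∣p∣≡0 empty)) ∣C∣≡ω) z≤n

  -- The properties shared by the intersection D and the union F of any
  -- nonempty family of maximum cliques; size is Hajnal's inequality.
  record Hajnal (D F : Subset n) : Set where
    field
      D⊆F      : D ⊆ F
      complete : ∀ {u v} → u ∈ D → v ∈ F → u ≢ v → Adj G u v
      size     : ω G + ω G ≤ ∣ D ∣ + ∣ F ∣
  open Hajnal

  hajnal-single : ∀ {C} → IsMaximum C → Hajnal C C
  hajnal-single (clique , ∣C∣≡ω) = record
    { D⊆F      = id
    ; complete = clique _ _
    ; size     = ℕ.≤-reflexive (cong₂ _+_ (sym ∣C∣≡ω) (sym ∣C∣≡ω))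
    }

  -- The inequality persists because (Q ∩ F) ∪ D is a clique, hence has at most
  -- ω G elements.
  hajnal-step : ∀ {D F Q} → IsMaximum Q → Hajnal D F → Hajnal (Q ∩ D) (Q ∪ F)
  hajnal-step {D} {F} {Q} (clique , ∣Q∣≡ω) h = record
    { D⊆F      = q⊆p∪q Q F ∘ D⊆F h ∘ p∩q⊆q Q D
    ; complete = λ u∈ v∈ u≢v → let u∈Q , u∈D = x∈p∩q⁻ Q D u∈ in
        [ (λ v∈Q → clique _ _ u∈Q v∈Q u≢v) , (λ v∈F → complete h u∈D v∈F u≢v) ]′ (x∈p∪q⁻ Q F v∈)
    ; size     = exchange {ω G} (size h)
        (begin
          ∣ Q ∩ F ∣ + ∣ D ∣            ≡⟨ ∣p∪q∣+∣p∩q∣≡∣p∣+∣q∣ (Q ∩ F) D ⟨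
          ∣ K ∣ + ∣ (Q ∩ F) ∩ D ∣      ≤⟨ ℕ.+-mono-≤ (ω-greatest G K K-clique) (p⊆q⇒∣p∣≤∣q∣ ⊆Q∩D) ⟩
          ω G + ∣ Q ∩ D ∣              ∎)
        (trans (∣p∪q∣+∣p∩q∣≡∣p∣+∣q∣ Q F) (cong (_+ ∣ F ∣) ∣Q∣≡ω))
    }
    where
    open ℕ.≤-Reasoning
    K = (Q ∩ F) ∪ D
    ⊆Q∩D : (Q ∩ F) ∩ D ⊆ Q ∩ D
    ⊆Q∩D v∈ = let v∈QF , v∈D = x∈p∩q⁻ (Q ∩ F) D v∈ in x∈p∩q⁺ (p∩q⊆p Q F v∈QF , v∈D)
    K-clique : IsClique G K
    K-clique u v u∈ v∈ u≢v with x∈p∪q⁻ (Q ∩ F) D u∈ | x∈p∪q⁻ (Q ∩ F) D v∈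
    ... | inj₁ u∈QF | inj₁ v∈QF = clique u v (p∩q⊆p Q F u∈QF) (p∩q⊆p Q F v∈QF) u≢v
    ... | inj₁ u∈QF | inj₂ v∈D  = adj-sym G (complete h v∈D (p∩q⊆q Q F u∈QF) (u≢v ∘ sym))
    ... | inj₂ u∈D  | inj₁ v∈QF = complete h u∈D (p∩q⊆q Q F v∈QF) u≢v
    ... | inj₂ u∈D  | inj₂ v∈D  = complete h u∈D (D⊆F h v∈D) u≢v

  -- F lies in the closed neighbourhood of any vertex of D.
  intersection-bound : ∀ {D F} → Hajnal D F → Nonempty D → ω G + ω G ≤ ∣ D ∣ + suc (Δ G)
  intersection-bound {D} {F} h (v , v∈D) = ≤-trans (size h) (ℕ.+-monoʳ-≤ ∣ D ∣
    (closed-neighbourhood-bound F λ u∈F v≢u → complete h v∈D u∈F v≢u))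

  meet-bound : ∀ {A B} → IsMaximum A → IsMaximum B → Nonempty (A ∩ B) →
    ω G + ω G ≤ ∣ A ∩ B ∣ + suc (Δ G)
  meet-bound A-max B-max = intersection-bound (hajnal-step A-max (hajnal-single B-max))

  maximumCliques : List (Subset n)
  maximumCliques = filter isMaximum? (subsets n)

  ∈-maximumCliques⁺ : ∀ {C} → IsMaximum C → C ∈ˡ maximumCliques
  ∈-maximumCliques⁺ = ∈-filter⁺ isMaximum? (∈-subsets _)

  ∈-maximumCliques⁻ : ∀ {C} → C ∈ˡ maximumCliques → IsMaximum C
  ∈-maximumCliques⁻ = proj₂ ∘ ∈-filter⁻ isMaximum? {xs = subsets n}

  -- The maximum cliques that share a vertex with C.
  meeting : Subset n → List (Subset n)
  meeting C = filter (λ Q → nonempty? (C ∩ Q)) maximumCliques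

  -- The common part of C and all maximum cliques that meet C.
  core : Subset n → Subset n
  core C = foldr _∩_ C (meeting C)

  core⊆ : ∀ C → core C ⊆ C
  core⊆ C = foldr-∩-⊆ C (meeting C)

  core⊆-meeting : ∀ {C Q} → IsMaximum Q → Nonempty (C ∩ Q) → core C ⊆ Q
  core⊆-meeting {C} Q-max C∩Q =
    foldr-∩-⊆-∈ (∈-filter⁺ (λ Q → nonempty? (C ∩ Q)) (∈-maximumCliques⁺ Q-max) C∩Q)

  -- Independent sets that meet every maximum clique

  module _ (dense : 3 * suc (Δ G) ≤ 4 * ω G) where

    private
      s w d : ℕ
      s = suc (Δ G)
      w = ω G
      d = s ∸ w

      d+w≡s : d + w ≡ s
      d+w≡s = ℕ.m∸n+n≡m ω≤1+Δ

    meets-trans : ∀ {A B C} → IsMaximum A → IsMaximum B → IsMaximum C →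
      Nonempty (A ∩ B) → Nonempty (B ∩ C) → Nonempty (A ∩ C)
    meets-trans {A} {B} {C} A-max B-max C-max A∩B B∩C =
      let v , v∈ = overfull⇒meet (p∩q⊆q A B) (p∩q⊆p B C) (subst (_< _) (sym (proj₂ B-max))
            (overfull {w} {s} (s≤s z≤n) dense
              (meet-bound A-max B-max A∩B) (meet-bound B-max C-max B∩C)))
          v∈AB , v∈BC = x∈p∩q⁻ (A ∩ B) (B ∩ C) v∈
      in v , x∈p∩q⁺ (p∩q⊆p A B v∈AB , p∩q⊆q B C v∈BC)

    -- A further clique Q keeps the intersection D nonempty: Q ∩ C and D are both
    -- too large to be disjoint subsets of C.
    core-hajnal : ∀ {C} → IsMaximum C → Nonempty C → ∀ Qs →
      (∀ {Q} → Q ∈ˡ Qs → IsMaximum Q × Nonempty (C ∩ Q)) →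
      Hajnal (foldr _∩_ C Qs) (foldr _∪_ C Qs) × Nonempty (foldr _∩_ C Qs)
    core-hajnal C-max C≠∅ [] _ = hajnal-single C-max , C≠∅
    core-hajnal {C} C-max C≠∅ (Q ∷ Qs) meet
      with core-hajnal C-max C≠∅ Qs (meet ∘ there) | meet (here refl)
    ... | h , D≠∅ | Q-max , C∩Q = hajnal-step Q-max h ,
      let v , v∈ = overfull⇒meet (p∩q⊆p C Q) (foldr-∩-⊆ C Qs) (subst (_< _) (sym (proj₂ C-max))
            (overfull {w} {s} (s≤s z≤n) dense
              (meet-bound C-max Q-max C∩Q) (intersection-bound h D≠∅)))
          v∈CQ , v∈D = x∈p∩q⁻ (C ∩ Q) _ v∈
      in v , x∈p∩q⁺ (p∩q⊆q C Q v∈CQ , v∈D)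

    core-bound : ∀ {C} → IsMaximum C → w + w ≤ ∣ core C ∣ + s × Nonempty (core C)
    core-bound {C} C-max =
      let h , D≠∅ = core-hajnal C-max C≠∅ (meeting C) λ Q∈ →
            let Q∈max , C∩Q = ∈-filter⁻ (λ Q → nonempty? (C ∩ Q)) {xs = maximumCliques} Q∈
            in ∈-maximumCliques⁻ Q∈max , C∩Q
      in intersection-bound h D≠∅ , D≠∅
      where
      -- If the clique number were 0, density would fail.
      C≠∅ : Nonempty C
      C≠∅ = decidable-stable (nonempty? C) λ C=∅ → contradiction dense (ℕ.<⇒≱
        (subst (λ k → 4 * k < 3 * s) (trans (sym (empty⇒∣p∣≡0 C=∅)) (proj₂ C-max)) (s≤s z≤n)))

    core-large : ∀ {C} → IsMaximum C → d + d ≤ ∣ core C ∣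
    core-large C-max = roomy {w} {s} d+w≡s dense (proj₁ (core-bound C-max))

    -- The graph of those edges of G that lie in no maximum clique.
    crossing : Graph n
    crossing = record
      { Adj     = λ u v → Adj G u v × ¬ Any (λ C → u ∈ C × v ∈ C) maximumCliques
      ; adj?    = λ u v → adj? G u v ×-dec
          ¬? (Any.any? (λ C → u ∈? C ×-dec v ∈? C) maximumCliques)
      ; adj-sym = λ (uv , apart) → adj-sym G uv , apart ∘ Any.map (λ (v∈C , u∈C) → u∈C , v∈C)
      ; irrefl  = λ u≡v → irrefl G u≡v ∘ proj₁
      }

    -- The crossing neighbours of v are disjoint from C, and together with C they
    -- lie in the closed neighbourhood of v.
    crossing-degree : ∀ {C v} → IsMaximum C → v ∈ C → degree crossing v ≤ d
    crossing-degree {C} {v} C-max v∈C = ℕ.+-cancelʳ-≤ w _ _ (begin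
      degree crossing v + w            ≡⟨ cong (λ k → degree crossing v + k) (proj₂ C-max) ⟨
      degree crossing v + ∣ C ∣        ≡⟨ ∣p∪q∣≡∣p∣+∣q∣ N C dis ⟨
      ∣ N ∪ C ∣                        ≤⟨ closed-neighbourhood-bound {v} (N ∪ C) (λ u∈ v≢u →
                                            [ (λ u∈N → proj₁ (∈-neighbours⁻ crossing u∈N))
                                            , (λ u∈C → proj₁ C-max _ _ v∈C u∈C v≢u)
                                            ]′ (x∈p∪q⁻ N C u∈)) ⟩
      s                                ≡⟨ d+w≡s ⟨
      d + w                            ∎)
      where
      open ℕ.≤-Reasoning
      N = neighbours crossing v
      dis : Disjoint N C
      dis (u , u∈) = let u∈N , u∈C = x∈p∩q⁻ N C u∈ in
        proj₂ (∈-neighbours⁻ crossing u∈N) (lose (∈-maximumCliques⁺ C-max) (v∈C , u∈C))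

    -- Pairwise disjoint maximum cliques that together meet every clique in Cs.
    record Representatives (Cs : List (Subset n)) : Set where
      field
        reps     : List (Subset n)
        maximum  : ∀ {R} → R ∈ˡ reps → IsMaximum R
        disjoint : ∀ {R S} → R ∈ˡ reps → S ∈ˡ reps → R ≢ S → Disjoint R S
        cover    : ∀ {C} → C ∈ˡ Cs → ∃[ R ] (R ∈ˡ reps × Nonempty (R ∩ C))

    representatives : ∀ Cs → (∀ {C} → C ∈ˡ Cs → IsMaximum C) → Representatives Cs
    representatives [] _ = record
      { reps = [] ; maximum = λ () ; disjoint = λ () ; cover = λ () }
    representatives (C ∷ Cs) all-max = add (Any.any? (λ R → nonempty? (R ∩ C)) reps)
      where
      open Representatives (representatives Cs (all-max ∘ there))
      C≠∅ : Nonempty (C ∩ C)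
      C≠∅ = let v , v∈ = proj₂ (core-bound (all-max (here refl)))
            in v , x∈p∩q⁺ (core⊆ C v∈ , core⊆ C v∈)
      add : Dec (Any (λ R → Nonempty (R ∩ C)) reps) → Representatives (C ∷ Cs)
      add (yes meets) = record
        { reps     = reps
        ; maximum  = maximum
        ; disjoint = disjoint
        ; cover    = λ { (here refl) → find meets ; (there C∈) → cover C∈ }
        }
      add (no avoids) = record
        { reps     = C ∷ reps
        ; maximum  = λ { (here refl) → all-max (here refl) ; (there R∈) → maximum R∈ }
        ; disjoint = λ
            { (here refl) (here refl) C≢C → contradiction refl C≢C
            ; (here refl) (there S∈)  _   → avoids ∘ lose S∈ ∘ ∩-nonempty-sym
            ; (there R∈)  (here refl) _   → avoids ∘ lose R∈
            ; (there R∈)  (there S∈)  R≢S → disjoint R∈ S∈ R≢S }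
        ; cover    = λ
            { (here refl) → C , here refl , C≠∅
            ; (there C∈)  → let R , R∈ , R∩C = cover C∈ in R , there R∈ , R∩C }
        }

    _≟ₛ_ : DecidableEquality (Subset n)
    _≟ₛ_ = Vec.≡-dec Bool._≟_

    -- The parts are the cores of the representatives.
    open IndependentTransversals _≟ₛ_ core d

    transversal : Fin n → (Rs : Representatives maximumCliques) →
      Transversal crossing ⊥ (Representatives.reps Rs)
    transversal v₀ Rs =
      independent-transversal v₀ admissible (λ R∈ → proj₂ (core-bound (maximum R∈)))
      where
      open Representatives Rs
      admissible : Admissible crossing ⊥ reps
      admissible = record
        { root-disjoint = λ { _ (v , v∈) → ∉⊥ (p∩q⊆p ⊥ _ v∈) }
        ; disjoint      = λ {R} {S} R∈ S∈ R≢S (v , v∈) →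
            let v∈R , v∈S = x∈p∩q⁻ (core R) (core S) v∈
            in disjoint R∈ S∈ R≢S (v , x∈p∩q⁺ (core⊆ R v∈R , core⊆ S v∈S))
        ; large         = λ R∈ → core-large (maximum R∈)
        ; root-degree   = λ v∈⊥ → contradiction v∈⊥ ∉⊥
        ; part-degree   = λ {R} R∈ v∈ → crossing-degree (maximum R∈) (core⊆ R v∈)
        }

    module _ (Rs : Representatives maximumCliques)
      (T : Transversal crossing ⊥ (Representatives.reps Rs)) where
      open Representatives Rs
      open Transversal T

      -- A maximum clique containing the picks of R and S would meet both, so
      -- that R and S meet and hence are equal.
      pick-indep : ∀ {R S} → R ∈ˡ reps → S ∈ˡ reps → ¬ Adj G (pick R) (pick S)
      pick-indep {R} {S} R∈ S∈ RS = indep R∈ S∈ (RS , λ common →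
        let C , C∈ , r∈C , s∈C = find common
            R∩S = meets-trans {R} {C} {S} (maximum R∈) (∈-maximumCliques⁻ C∈) (maximum S∈)
              (pick R , x∈p∩q⁺ (core⊆ R (in-part R∈) , r∈C))
              (pick S , x∈p∩q⁺ (s∈C , core⊆ S (in-part S∈)))
            R≡S = decidable-stable (R ≟ₛ S) λ R≢S → disjoint R∈ S∈ R≢S R∩S
        in irrefl G (cong pick R≡S) RS)

      picks-independent : ∀ {u v} → u ∈ˡ map pick reps → v ∈ˡ map pick reps → ¬ Adj G u v
      picks-independent u∈ v∈ uv =
        let R , R∈ , u≡ = ∈-map⁻ pick u∈
            S , S∈ , v≡ = ∈-map⁻ pick v∈
        in pick-indep R∈ S∈ (subst₂ (Adj G) u≡ v≡ uv)

      picks-hit : ∀ {C} → IsMaximum C → ∃[ v ] (v ∈ˡ map pick reps × v ∈ C)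
      picks-hit {C} C-max = let R , R∈ , R∩C = cover (∈-maximumCliques⁺ C-max) in
        pick R , ∈-map⁺ pick R∈ , core⊆-meeting {R} {C} C-max R∩C (in-part R∈)

    hitting-set : Fin n → ∃[ J ]
      ((∀ {u v} → u ∈ˡ J → v ∈ˡ J → ¬ Adj G u v) ×
       (∀ {C} → IsMaximum C → ∃[ v ] (v ∈ˡ J × v ∈ C)))
    hitting-set v₀ =
      map (Transversal.pick T) (Representatives.reps Rs) , picks-independent Rs T , picks-hit Rs T
      where
      Rs = representatives maximumCliques ∈-maximumCliques⁻
      T  = transversal v₀ Rs

-- Maximal independent sets

-- Sets of vertices are given here by lists, in which repetitions are harmless.
module _ (G : Graph n) where

  Independent : List (Fin n) → Set
  Independent J = ∀ {u v} → u ∈ˡ J → v ∈ˡ J → ¬ Adj G u v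

  -- The vertex v lies in J or has a neighbour in J.
  Dominated : List (Fin n) → Fin n → Set
  Dominated J v = v ∈ˡ J ⊎ ∃[ u ] (u ∈ˡ J × Adj G v u)

  -- An independent set that contains I and dominates the vertices vs.
  record Extension (I vs : List (Fin n)) : Set where
    field
      set         : List (Fin n)
      independent : Independent set
      contains    : ∀ {v} → v ∈ˡ I → v ∈ˡ set
      dominates   : ∀ {v} → v ∈ˡ vs → Dominated set v

  extension : ∀ {I} → Independent I → ∀ vs → Extension I vs
  extension {I} I-indep [] = record
    { set = I ; independent = I-indep ; contains = id ; dominates = λ () }
  extension {I} I-indep (v ∷ vs) = add (Any.any? (adj? G v) J)
    where
    open Extension (extension I-indep vs) renaming (set to J)
    add : Dec (Any (Adj G v) J) → Extension I (v ∷ vs)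
    add (yes adjacent) = record
      { set         = J
      ; independent = independent
      ; contains    = contains
      ; dominates   = λ { (here refl) → inj₂ (find adjacent) ; (there u∈) → dominates u∈ }
      }
    add (no isolated) = record
      { set         = v ∷ J
      ; independent = λ
          { (here refl) (here refl) → irrefl G refl
          ; (here refl) (there u∈)  → isolated ∘ lose u∈
          ; (there u∈)  (here refl) → isolated ∘ lose u∈ ∘ adj-sym G
          ; (there u∈)  (there w∈)  → independent u∈ w∈ }
      ; contains    = there ∘ contains
      ; dominates   = λ
          { (here refl) → inj₁ (here refl)
          ; (there u∈)  → [ inj₁ ∘ there , (λ (w , w∈J , uw) → inj₂ (w , there w∈J , uw)) ]′
              (dominates u∈) }
      }

-- Deleting an independent set

module Deletion (G : Graph n) (J : List (Fin n)) where

  open DecMembership (_≟ᶠ_ {n}) using () renaming (_∈?_ to _∈ˡ?_)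

  kept : List (Fin n)
  kept = filter (λ v → ¬? (v ∈ˡ? J)) (allFin n)

  embed : Fin (length kept) ↣ Fin n
  embed = mk↣ (lookup-injective (filter⁺ (λ v → ¬? (v ∈ˡ? J)) (allFin⁺ n)))

  open Injection embed using (to; injective)

  -- The induced subgraph on the vertices outside J.
  H : Graph (length kept)
  H = induced G embed

  to∉J : ∀ i → to i ∉ˡ J
  to∉J i = proj₂ (∈-filter⁻ (λ v → ¬? (v ∈ˡ? J)) {xs = allFin n} (∈-lookup i))

  missed : ∀ {v} → v ∈ˡ J → ∀ i → to i ≢ v
  missed v∈J i refl = to∉J i v∈J

  from : ∀ {v} → v ∉ˡ J → ∃[ i ] to i ≡ v
  from {v} v∉J = Any.index v∈kept , sym (lookup-index v∈kept)
    where
    v∈kept : v ∈ˡ kept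
    v∈kept = ∈-filter⁺ (λ v → ¬? (v ∈ˡ? J)) (∈-allFin v) v∉J

  fewer-vertices : ∀ {v} → v ∈ˡ J → length kept < n
  fewer-vertices v∈J = subst₂ _<_ (∣⊤∣≡n (length kept)) (∣⊤∣≡n n)
    (image-< to injective {⊤} {⊤} (λ _ → ∈⊤) ∈⊤ (missed v∈J))

  χ-drop : Independent G J → χ G ≤ suc (χ H)
  χ-drop J-indep =
    χ-least G ((λ v → colour v (v ∈ˡ? J)) , λ u v → proper (u ∈ˡ? J) (v ∈ˡ? J))
    where
    c = proj₁ (χ-colourable H)
    c-proper = proj₂ (χ-colourable H)
    colour : ∀ v → Dec (v ∈ˡ J) → Fin (suc (χ H))
    colour v (yes _)  = zero
    colour v (no v∉J) = suc (c (proj₁ (from v∉J)))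
    proper : ∀ {u v} u∈? v∈? → Adj G u v → colour u u∈? ≢ colour v v∈?
    proper (yes u∈J) (yes v∈J) uv _  = J-indep u∈J v∈J uv
    proper (yes _)   (no _)    _  ()
    proper (no _)    (yes _)   _  ()
    proper (no u∉J)  (no v∉J)  uv eq = c-proper _ _
      (subst₂ (Adj G) (sym (proj₂ (from u∉J))) (sym (proj₂ (from v∉J))) uv)
      (Fin.suc-injective eq)

  ω-drop : (∀ {C} → IsMaximum G C → ∃[ v ] (v ∈ˡ J × v ∈ C)) → ω H < ω G
  ω-drop hits = ℕ.≤∧≢⇒< (subst (_≤ ω G) ∣C∣≡ω (ω-greatest G C C-clique)) λ ωH≡ωG →
    let v , v∈J , v∈C = hits (C-clique , trans ∣C∣≡ω ωH≡ωG)
        i , _ , i↦v   = ∈-image⁻ to S v∈C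
    in missed v∈J i i↦v
    where
    S = proj₁ (ω-clique H)
    C = image to S
    ∣C∣≡ω : ∣ C ∣ ≡ ω H
    ∣C∣≡ω = trans (∣image∣ to injective S) (proj₂ (proj₂ (ω-clique H)))
    C-clique : IsClique G C
    C-clique u v u∈ v∈ u≢v =
      let i , i∈S , i↦u = ∈-image⁻ to S u∈
          j , j∈S , j↦v = ∈-image⁻ to S v∈
      in subst₂ (Adj G) i↦u j↦v (proj₁ (proj₂ (ω-clique H)) i j i∈S j∈S
           λ i≡j → u≢v (trans (sym i↦u) (trans (cong to i≡j) j↦v)))

  degree-drop : (∀ v → Dominated G J v) → ∀ i → degree H i < degree G (to i)
  degree-drop dominated i with dominated (to i)
  ... | inj₁ i∈J            = contradiction i∈J (to∉J i)
  ... | inj₂ (u , u∈J , iu) = image-< to injective {neighbours H i} {neighbours G (to i)}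
    (∈-neighbours⁺ G ∘ ∈-neighbours⁻ H) (∈-neighbours⁺ G iu) (missed u∈J)

-- The induction

-- Reed's bound ⌈(ω + Δ + 1)/2⌉, with the ceiling taken in ℕ.
reedBound : Graph n → ℕ
reedBound G = ⌈ ω G + Δ G + 1 /2⌉

χ≤n : (G : Graph n) → χ G ≤ n
χ≤n G = χ-least G (id , λ { u .u uu refl → irrefl G refl uu })

bound-drop : ∀ {w w′ D D′} → w′ < w → D′ < D → suc ⌈ w′ + D′ + 1 /2⌉ ≤ ⌈ w + D + 1 /2⌉
bound-drop {w} {w′} {D} {D′} w′<w D′<D = ℕ.⌈n/2⌉-mono (begin
  2 + (w′ + D′ + 1)     ≡⟨ solve 2 (λ w D → con 2 :+ (w :+ D :+ con 1)
                             := (con 1 :+ w) :+ (con 1 :+ D) :+ con 1) refl w′ D′ ⟩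
  suc w′ + suc D′ + 1   ≤⟨ ℕ.+-monoˡ-≤ 1 (ℕ.+-mono-≤ w′<w D′<D) ⟩
  w + D + 1             ∎)
  where open ℕ.≤-Reasoning; open +-*-Solver

bound-positive : ∀ {w w′} D → w′ < w → 1 ≤ ⌈ w + D + 1 /2⌉
bound-positive {suc w} D _ = ℕ.⌈n/2⌉-mono {1} (s≤s z≤n)

-- A dense nonempty graph has a smaller induced subgraph from which the bound
-- carries over.
reduction : ∀ {n} (G : Graph (suc n)) → 3 * suc (Δ G) ≤ 4 * ω G →
  ∃[ m ] ∃[ f ] (m < suc n ×
    (χ (induced {m = m} G f) ≤ reedBound (induced G f) → χ G ≤ reedBound G))
reduction {n} G dense = length kept , embed , fewer-vertices v∈J , λ bound → ≤-trans
  (χ-drop independent)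
  (conclude H (χ≤n H) (ω-drop hits) (degree-drop λ v → dominates (∈-allFin v)) bound)
  where
  hitting = hitting-set G dense zero
  open Extension (extension G {proj₁ hitting} (proj₁ (proj₂ hitting)) (allFin _))
    renaming (set to J)
  open Deletion G J

  hits : ∀ {C} → IsMaximum G C → ∃[ v ] (v ∈ˡ J × v ∈ C)
  hits {C} C-max =
    let v , v∈I , v∈C = proj₂ (proj₂ hitting) {C} C-max in v , contains v∈I , v∈C

  v∈J = proj₁ (proj₂ (hits {proj₁ (ω-clique G)} (proj₂ (ω-clique G))))

  conclude : ∀ {m} {to : Fin m → Fin (suc n)} (H : Graph m) → χ H ≤ m → ω H < ω G →
    (∀ i → degree H i < degree G (to i)) → χ H ≤ reedBound H → suc (χ H) ≤ reedBound G
  -- When no vertex is left, Δ H is 0 by convention and need not be below Δ G.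
  conclude {zero}  H χH≤0 ωH<ωG _ _ =
    ≤-trans (s≤s χH≤0) (bound-positive {ω G} {ω H} (Δ G) ωH<ωG)
  conclude {suc m} {to} H _ ωH<ωG degrees bound =
    ≤-trans (s≤s bound) (bound-drop {ω G} {ω H} {Δ G} {Δ H} ωH<ωG ΔH<ΔG)
    where
    ΔH<ΔG : Δ H < Δ G
    ΔH<ΔG = let i , degree≡Δ = Δ-attained H in
      subst (_< Δ G) degree≡Δ (ℕ.<-≤-trans (degrees i) (degree≤Δ G (to i)))

-- The hypothesis on one graph, in terms of its chromatic number c, clique
-- number w and maximum degree D.
record WeakBound (c w D : ℕ) : Set where
  constructor weak
  field bound : + c ℤ.≤ ⌈ (+ 7 / 6) ℚ.* (+ w / 1) ⌉ ℤ.⊔ ⌈ + (w + D + 1) / 2 ⌉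

sparse-or-dense : ∀ w D → 7 * w ≤ 3 * (w + D + 1) ⊎ 3 * suc D ≤ 4 * w
sparse-or-dense w D with ℕ.≤-total (7 * w) (3 * (w + D + 1))
... | inj₁ sparse     = inj₁ sparse
... | inj₂ 3[w+s]≤7w = inj₂ (ℕ.+-cancelˡ-≤ (3 * w) _ _ (begin
  3 * w + 3 * suc D   ≡⟨ solve 2 (λ w D → con 3 :* w :+ con 3 :* (con 1 :+ D)
                           := con 3 :* (w :+ D :+ con 1)) refl w D ⟩
  3 * (w + D + 1)     ≤⟨ 3[w+s]≤7w ⟩
  7 * w               ≡⟨ solve 1 (λ w → con 7 :* w := con 3 :* w :+ con 4 :* w) refl w ⟩
  3 * w + 4 * w       ∎))
  where open ℕ.≤-Reasoning; open +-*-Solver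

bounded-or-dense : ∀ c w D → WeakBound c w D → c ≤ ⌈ w + D + 1 /2⌉ ⊎ 3 * suc D ≤ 4 * w
bounded-or-dense c w D (weak c≤max) = map₁ sparse-case (sparse-or-dense w D)
  where
  open ℤ.≤-Reasoning
  k = w + D + 1
  sparse-case : 7 * w ≤ 3 * k → c ≤ ⌈ k /2⌉
  sparse-case sparse = ℤ.drop‿+≤+ (begin
    + c                                               ≤⟨ c≤max ⟩
    ⌈ (+ 7 / 6) ℚ.* (+ w / 1) ⌉ ℤ.⊔ ⌈ + k / 2 ⌉       ≤⟨ ℤ.⊔-lub
                                                           (7w≤3k⇒⌈7w/6⌉≤⌈k/2⌉ w k sparse)
                                                           (ℤ.≤-reflexive (⌈+k/2⌉≡+⌈k/2⌉ k)) ⟩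
    + ⌈ k /2⌉                                         ∎)

-- The hypothesis on the graph G.
Weak : Graph n → Set
Weak G = WeakBound (χ G) (ω G) (Δ G)

-- Induction on an upper bound k for the number of vertices.
χ≤reedBound : ∀ k {n} → n ≤ k → (G : Graph n) →
  (∀ {m} (f : Fin m ↣ Fin n) → Weak (induced G f)) → χ G ≤ reedBound G
χ≤reedBound k       {zero}  _         G hyp = ≤-trans (χ≤n G) z≤n
χ≤reedBound (suc k) {suc n} (s≤s n≤k) G hyp =
  [ id , dense-case ]′ (bounded-or-dense (χ G) (ω G) (Δ G) (hyp (↣-id _)))
  where
  dense-case : 3 * suc (Δ G) ≤ 4 * ω G → χ G ≤ reedBound G
  dense-case dense = let m , f , m<1+n , carry-over = reduction G dense in
    carry-over (χ≤reedBound k (≤-trans (s≤s⁻¹ m<1+n) n≤k) (induced G f) (λ g → hyp (f ↣-∘ g)))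

theoremD : ∀ {n : ℕ} (G : Graph n) →
    (∀ {m : ℕ} (f : Fin m ↣ Fin n) → let H = induced G f in
    + χ H ℤ.≤ ⌈ (+ 7 / 6) ℚ.* (+ ω H / 1) ⌉ ℤ.⊔ ⌈ + (ω H + Δ H + 1) / 2 ⌉) →
    + χ G ℤ.≤ ⌈ + (ω G + Δ G + 1) / 2 ⌉
theoremD {n} G hyp = subst (+ χ G ℤ.≤_) (sym (⌈+k/2⌉≡+⌈k/2⌉ (ω G + Δ G + 1)))
  (ℤ.+≤+ (χ≤reedBound n ≤-refl G (λ f → weak (hyp f))))
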